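{- Let $E/F$ be a quadratic extension of number fields, let $D$ be a central division algebra of degree three over $E$, and let $\alpha$ be an involution of the second kind on $D$ (with respect to $E/F$). Let $SU=\{g\in D^\times\mid \alpha(g)g=1,\ \mathrm{N}_{rd}(g)=1\}$ be the associated special unitary group. Then $SU$ does not contain non-trivial elements of (finite) even order. In particular, there are no reflections in $SU$.
   Context: Let $\tau$ be the non-trivial element of $\mathrm{Gal}(E/F)$. An involution of the second kind on $D$ is a ring anti-automorphism $\alpha:D\to D$ with $\alpha\circ\alpha=\mathrm{id}$ whose restriction to the center $E$ is $\tau$. $\mathrm{N}_{rd}:D\to E$ denotes the reduced norm. A reflection is an element $R\neq 1$ of the group with $R^2=1$. -}

module Defs where

open import Algebra.Bundles using (CommutativeRing; Ring)
open import Algebra.Bundles.Raw using (RawRing)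
import Algebra.Construct.Flip.Op as Op
open import Algebra.Definitions using (Invertible)
import Algebra.Definitions.RawSemiring as RawSemiringDefs
open import Algebra.Morphism.Structures using (IsRingHomomorphism; IsRingIsomorphism)
open import Data.Bool.Base using (if_then_else_)
open import Data.Fin.Base using (Fin; zero; suc; toℕ; punchIn)
open import Data.Fin.Properties using (_≟_)
open import Data.Nat.Base as ℕ using (ℕ; zero; suc)
open import Data.Product.Base using (Σ-syntax; ∃-syntax; _×_)
import Data.Rational.Properties as ℚ
open import Data.Vec.Functional using (Vector)
open import Function.Base using (_∘_)
open import Level using (Level; _⊔_) renaming (suc to lsuc)
open import Relation.Nullary.Decidable.Core using (does)
open import Relation.Nullary.Negation using (¬_)
open import Relation.Unary using (Pred)

private
  variable
    a b d e f ℓa ℓb ℓd ℓe ℓf : Level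

record IsDivisionRing (R : Ring a ℓa) : Set (a ⊔ ℓa) where
  open Ring R
  field
    1≉0     : ¬ (1# ≈ 0#)
    inverse : ∀ x → ¬ (x ≈ 0#) → Invertible _≈_ 1# _*_ x

IsField : CommutativeRing a ℓa → Set (a ⊔ ℓa)
IsField K = IsDivisionRing (CommutativeRing.ring K)

-- A is regarded as a left K-module through ι, i.e. x ∙ v = ι x * v.  The
-- definitions are on raw rings so that they also apply to matrix rings.
module _ (K : RawRing a ℓa) (A : RawRing b ℓb)
         (ι : RawRing.Carrier K → RawRing.Carrier A) where

  private
    module K = RawRing K
    module A = RawRing A
  open RawSemiringDefs A.rawSemiring using (sum)

  combination : ∀ {n} → Vector K.Carrier n → Vector A.Carrier n → A.Carrier
  combination x v = sum (λ i → ι (x i) A.* v i)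

  record IsBasis {n : ℕ} (v : Vector A.Carrier n) : Set (a ⊔ ℓa ⊔ b ⊔ ℓb) where
    field
      spanning    : ∀ y → ∃[ x ] (combination x v A.≈ y)
      independent : ∀ x → combination x v A.≈ A.0# → ∀ i → x i K.≈ K.0#

  HasDimension : ℕ → Set (a ⊔ ℓa ⊔ b ⊔ ℓb)
  HasDimension n = Σ[ v ∈ Vector A.Carrier n ] IsBasis v

record IsNumberField (K : CommutativeRing a ℓa) : Set (a ⊔ ℓa) where
  open CommutativeRing K using (Carrier; rawRing)
  field
    isField      : IsField K
    fromℚ        : CommutativeRing.Carrier ℚ.+-*-commutativeRing → Carrier
    fromℚ-isHomo : IsRingHomomorphism (CommutativeRing.rawRing ℚ.+-*-commutativeRing) rawRing fromℚ
    degree       : ℕ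
    finite       : HasDimension (CommutativeRing.rawRing ℚ.+-*-commutativeRing) rawRing fromℚ degree

module _ (F : CommutativeRing f ℓf) (E : CommutativeRing e ℓe)
         (ι : CommutativeRing.Carrier F → CommutativeRing.Carrier E) where

  private
    module F = CommutativeRing F
    module E = CommutativeRing E

  record IsQuadraticExtension : Set (f ⊔ ℓf ⊔ e ⊔ ℓe) where
    field
      isHomo  : IsRingHomomorphism F.rawRing E.rawRing ι
      degree2 : HasDimension F.rawRing E.rawRing ι 2

  record IsNontrivialGaloisElement (τ : E.Carrier → E.Carrier) : Set (f ⊔ e ⊔ ℓe) where
    field
      isAutomorphism : IsRingIsomorphism E.rawRing E.rawRing τ
      fixesBase      : ∀ x → τ (ι x) E.≈ ι x
      nontrivial     : ¬ (∀ x → τ x E.≈ x)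

module Matrices (L : RawRing a ℓa) where

  open RawRing L
  open RawSemiringDefs rawSemiring using (sum; _^_)

  Matrix : ℕ → Set a
  Matrix n = Fin n → Fin n → Carrier

  scalar : ∀ {n} → Carrier → Matrix n
  scalar x i j = if does (i ≟ j) then x else 0#

  matrixRing : ℕ → RawRing a ℓa
  matrixRing n = record
    { Carrier = Matrix n
    ; _≈_     = λ A B → ∀ i j → A i j ≈ B i j
    ; _+_     = λ A B i j → A i j + B i j
    ; _*_     = λ A B i j → sum (λ k → A i k * B k j)
    ; -_      = λ A i j → - A i j
    ; 0#      = λ _ _ → 0#
    ; 1#      = scalar 1#
    }

  -- Laplace expansion along the first row.
  det : ∀ {n} → Matrix n → Carrier
  det {zero}  A = 1#
  det {suc n} A = sum λ j →
    (- 1#) ^ toℕ j * (A zero j * det (λ i k → A (suc i) (punchIn j k)))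

module _ (E : CommutativeRing e ℓe) (D : Ring d ℓd)
         (κ : CommutativeRing.Carrier E → Ring.Carrier D) where

  private
    module E = CommutativeRing E
    module D = Ring D

  record IsCentralDivisionAlgebra (n : ℕ) : Set (e ⊔ ℓe ⊔ d ⊔ ℓd) where
    field
      isDivisionRing  : IsDivisionRing D
      isHomo          : IsRingHomomorphism E.rawRing D.rawRing κ
      image⊆center    : ∀ x y → κ x D.* y D.≈ y D.* κ x
      center⊆image    : ∀ z → (∀ y → z D.* y D.≈ y D.* z) → ∃[ x ] (κ x D.≈ z)
      -- The degree is the square root of the dimension.
      degree          : HasDimension E.rawRing D.rawRing κ (n ℕ.* n)

  -- A ring anti-automorphism is a ring isomorphism onto the opposite ring.
  record IsInvolutionOfSecondKind (τ : E.Carrier → E.Carrier)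
                                  (α : D.Carrier → D.Carrier) : Set (e ⊔ d ⊔ ℓd) where
    field
      isAntiAutomorphism : IsRingIsomorphism D.rawRing (Ring.rawRing (Op.ring D)) α
      involutive         : ∀ x → α (α x) D.≈ x
      restrictsTo-τ      : ∀ x → α (κ x) D.≈ κ (τ x)

  -- A field extension L / E together with an isomorphism D ⊗_E L ≅ M_n(L) of
  -- L-algebras, given by its restriction φ to D.  An E-algebra homomorphism
  -- φ : D → M_n(L) extends uniquely to an L-linear map on D ⊗_E L, and since
  -- the v i ⊗ 1 form an L-basis of D ⊗_E L for every E-basis v of D, that
  -- extension is bijective iff φ maps E-bases of D to L-bases of M_n(L).
  record Splitting (n : ℕ) : Set (lsuc (e ⊔ ℓe) ⊔ d ⊔ ℓd) where
    field
      L       : CommutativeRing e ℓe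
      isField : IsField L

    module L = CommutativeRing L
    open Matrices L.rawRing public

    field
      ⌊_⌋       : E.Carrier → L.Carrier
      ⌊⌋-isHomo : IsRingHomomorphism E.rawRing L.rawRing ⌊_⌋
      φ         : D.Carrier → Matrix n
      φ-isHomo  : IsRingHomomorphism D.rawRing (matrixRing n) φ
      φ-linear  : ∀ x → RawRing._≈_ (matrixRing n) (φ (κ x)) (scalar ⌊ x ⌋)
      φ-basis   : ∀ {m} (v : Vector D.Carrier m) →
                  IsBasis E.rawRing D.rawRing κ v →
                  IsBasis L.rawRing (matrixRing n) scalar (φ ∘ v)

  -- Nrd x is the element of E whose image in L is det (φ x), for some
  -- splitting; it does not depend on which splitting is used.
  record IsReducedNorm (n : ℕ) (Nrd : D.Carrier → E.Carrier)
                       : Set (lsuc (e ⊔ ℓe) ⊔ d ⊔ ℓd) where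
    field
      splitting : Splitting n
    open Splitting splitting
    field
      Nrd-det : ∀ x → ⌊ Nrd x ⌋ L.≈ det (φ x)

module _ (E : CommutativeRing e ℓe) (D : Ring d ℓd) where

  private
    module E = CommutativeRing E
    module D = Ring D

  record SU (α : D.Carrier → D.Carrier) (Nrd : D.Carrier → E.Carrier)
            (g : D.Carrier) : Set (ℓe ⊔ d ⊔ ℓd) where
    field
      unit    : Invertible D._≈_ D.1# D._*_ g
      unitary : α g D.* g D.≈ D.1#
      special : Nrd g E.≈ E.1#

module _ (D : Ring d ℓd) where

  open Ring D
  open RawSemiringDefs (RawRing.rawSemiring rawRing) using (_^_)

  record HasOrder (g : Carrier) (n : ℕ) : Set ℓd where
    field
      positive : 0 ℕ.< n
      power    : g ^ n ≈ 1#
      minimal  : ∀ m → 0 ℕ.< m → m ℕ.< n → ¬ (g ^ m ≈ 1#)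

  IsReflection : Pred Carrier ℓd
  IsReflection R = ¬ (R ≈ 1#) × R * R ≈ 1#

{-# OPTIONS --safe #-}

-- If g ∈ SU has order 2q, then g ^ q ≠ 1 squares to 1, so g ^ q = -1 since D
-- has no zero divisors.  Taking reduced norms gives 1 = (-1)³ = -1 in the
-- splitting field, which has characteristic 0.  A reflection is the case q = 1.
module Submission where

open import Defs
open import Algebra.Bundles using (CommutativeRing; Ring)
open import Algebra.Bundles.Raw using (RawRing)
open import Algebra.Morphism.Construct.Composition using (isRingHomomorphism)
open import Algebra.Morphism.Structures using (IsRingHomomorphism)
import Algebra.Properties.Monoid.Sum as MonoidSum
import Algebra.Properties.Ring as RingProperties
import Algebra.Properties.Semiring.Exp as SemiringExp
import Algebra.Solver.Ring.NaturalCoefficients.Default as NaturalSolver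
open import Data.Fin.Base using (suc; toℕ; punchIn; combine; remQuot; splitAt; _↑ˡ_; _↑ʳ_)
open import Data.Fin.Patterns using (0F; 1F; 2F)
open import Data.Nat.Base as ℕ using (ℕ; zero; suc; z<s; s<s)
open import Data.Nat.Divisibility using (_∣_; divides)
open import Data.Nat.Properties using (m<m*n)
open import Data.Product.Base using (∃-syntax; _×_; _,_; proj₁; proj₂; uncurry)
open import Data.Rational.Base using (ℚ; ½; 1ℚ)
import Data.Rational.Properties as ℚ
open import Data.Sum.Base using ([_,_]′)
open import Data.Vec.Base using (Vec; _∷_; tabulate)
open import Relation.Binary.PropositionalEquality.Core as ≡ using (_≡_)
import Relation.Binary.Reasoning.Setoid as SetoidReasoning
open import Relation.Nullary.Negation using (¬_)

-- Square roots of one, and the consequence of -1 = 1 over the rationals.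

module _ {c ℓ} (R : Ring c ℓ) where

  open Ring R
  open RingProperties R
  open SetoidReasoning setoid

  -- Since `x` commutes with `1#`, the product `(x - 1#) * (x + 1#)` is `x * x - 1#`, hence zero;
  -- the nonzero left factor is cancelled by its inverse.
  x²≈1∧x≉1⇒x≈-1 : IsDivisionRing R → ∀ {x} → x * x ≈ 1# → ¬ (x ≈ 1#) → x ≈ - 1#
  x²≈1∧x≉1⇒x≈-1 isDivisionRing {x} x²≈1 x≉1 = +-inverseˡ-unique x 1# (begin
    x + 1#                        ≈⟨ *-identityˡ _ ⟨
    1# * (x + 1#)                 ≈⟨ *-congʳ y[x-1]≈1 ⟨
    y * (x - 1#) * (x + 1#)       ≈⟨ *-assoc _ _ _ ⟩
    y * ((x - 1#) * (x + 1#))     ≈⟨ *-congˡ [x-1][x+1]≈0 ⟩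
    y * 0#                        ≈⟨ zeroʳ y ⟩
    0#                            ∎)
    where
    x-1-invertible = IsDivisionRing.inverse isDivisionRing (x - 1#)
      (λ x-1≈0 → x≉1 (x∙y⁻¹≈ε⇒x≈y x 1# x-1≈0))

    y = proj₁ x-1-invertible

    y[x-1]≈1 : y * (x - 1#) ≈ 1#
    y[x-1]≈1 = proj₁ (proj₂ x-1-invertible)

    x[x+1]≈x+1 : x * (x + 1#) ≈ x + 1#
    x[x+1]≈x+1 = begin
      x * (x + 1#)     ≈⟨ distribˡ x x 1# ⟩
      x * x + x * 1#   ≈⟨ +-cong x²≈1 (*-identityʳ x) ⟩
      1# + x           ≈⟨ +-comm 1# x ⟩
      x + 1#           ∎

    [x-1][x+1]≈0 : (x - 1#) * (x + 1#) ≈ 0#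
    [x-1][x+1]≈0 = begin
      (x - 1#) * (x + 1#)             ≈⟨ [y-z]x≈yx-zx (x + 1#) x 1# ⟩
      x * (x + 1#) - 1# * (x + 1#)    ≈⟨ x≈y⇒x∙y⁻¹≈ε (trans x[x+1]≈x+1 (sym (*-identityˡ _))) ⟩
      0#                              ∎

  -- The image of `½` splits `1#` into two equal summands, which cancel once `- 1#` acts as `1#`.
  ℚ-algebra∧-1≈1⇒1≈0 : ∀ {h : ℚ → Carrier} →
    IsRingHomomorphism (CommutativeRing.rawRing ℚ.+-*-commutativeRing) rawRing h →
    - 1# ≈ 1# → 1# ≈ 0#
  ℚ-algebra∧-1≈1⇒1≈0 {h} isHomo -1≈1 = begin
    1#                   ≈⟨ 1#-homo ⟨
    h 1ℚ                 ≈⟨ +-homo ½ ½ ⟩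
    h ½ + h ½            ≈⟨ +-congˡ (*-identityˡ (h ½)) ⟨
    h ½ + 1# * h ½       ≈⟨ +-congˡ (*-congʳ -1≈1) ⟨
    h ½ + - 1# * h ½     ≈⟨ +-congˡ (-1*x≈-x (h ½)) ⟩
    h ½ - h ½            ≈⟨ -‿inverseʳ (h ½) ⟩
    0#                   ∎
    where open IsRingHomomorphism isHomo

-- Determinants of three by three matrices.

module Sarrus {c ℓ} (R : RawRing c ℓ) where

  open RawRing R
  open Matrices R using (Matrix)

  -- Working over a raw ring lets the same formulas be read both in a commutative ring and in the
  -- solver's polynomial expressions.
  evenTerms oddTerms : Matrix 3 → Carrier
  evenTerms A = A 0F 0F * (A 1F 1F * A 2F 2F)
              + (A 0F 1F * (A 1F 2F * A 2F 0F) + A 0F 2F * (A 1F 0F * A 2F 1F))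
  oddTerms  A = A 0F 0F * (A 1F 2F * A 2F 1F)
              + (A 0F 1F * (A 1F 0F * A 2F 2F) + A 0F 2F * (A 1F 1F * A 2F 0F))

  sarrus : Matrix 3 → Carrier
  sarrus A = evenTerms A + - 1# * oddTerms A

module Determinant {c ℓ} (R : CommutativeRing c ℓ) where

  open CommutativeRing R
  open RingProperties ring
  open SemiringExp semiring using (_^_)
  open Matrices rawRing
  open Sarrus rawRing
  open SetoidReasoning setoid
  private module Matrix₃ = RawRing (matrixRing 3)

  det-cong : ∀ {n} {A B : Matrix n} → (∀ i j → A i j ≈ B i j) → det A ≈ det B
  det-cong {zero}  A≈B = refl
  det-cong {suc n} A≈B = MonoidSum.sum-cong-≋ +-monoid λ j →
    *-congˡ {x = (- 1#) ^ toℕ j} (*-cong (A≈B 0F j) (det-cong λ i k → A≈B (suc i) (punchIn j k)))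

  private

    open NaturalSolver commutativeSemiring
      using (Polynomial; var; con; _:+_; _:*_; prove)

    -- The semiring solver knows no negation.  Determinants negate only 1#, so
    -- -1 becomes variable 0, followed by the entries of two matrices, and the
    -- identities below are taken modulo 1 + -1.
    polynomials : RawRing _ _
    polynomials = record
      { Carrier = Polynomial 19
      ; _≈_     = _≡_
      ; _+_     = _:+_
      ; _*_     = _:*_
      ; -_      = λ _ → var 0F
      ; 0#      = con 0
      ; 1#      = con 1
      }

    module Poly = Matrices polynomials
    module PolySarrus = Sarrus polynomials

    X Y : Poly.Matrix 3
    X i j = var (suc (combine i j ↑ˡ 9))
    Y i j = var (suc (9 ↑ʳ combine i j))

    XY : Poly.Matrix 3
    XY = RawRing._*_ (Poly.matrixRing 3) X Y

    -- `splitAt` and `remQuot` undo the index encoding of `X` and `Y`, so that `X i j` evaluates to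
    -- `A i j` and `Y i j` to `B i j`.
    env : Matrix 3 → Matrix 3 → Vec Carrier 19
    env A B = - 1# ∷ tabulate λ k →
      [ (λ l → uncurry A (remQuot 3 l)) , (λ l → uncurry B (remQuot 3 l)) ]′ (splitAt 9 k)

    ε : Polynomial 19
    ε = con 1 :+ var 0F

    -- Without subtraction, a congruence modulo `ε` is certified by adding a multiple of `ε` to each
    -- side; both multiples evaluate to zero.
    cancel-ε : ∀ {x y u v} → x + (1# - 1#) * u ≈ y + (1# - 1#) * v → x ≈ y
    cancel-ε {x} {y} {u} {v} eq = begin
      x                    ≈⟨ +ε≈ x u ⟨
      x + (1# - 1#) * u    ≈⟨ eq ⟩
      y + (1# - 1#) * v    ≈⟨ +ε≈ y v ⟩
      y                    ∎
      where
      +ε≈ : ∀ z w → z + (1# - 1#) * w ≈ z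
      +ε≈ z w = begin
        z + (1# - 1#) * w   ≈⟨ +-congˡ (*-congʳ (-‿inverseʳ 1#)) ⟩
        z + 0# * w          ≈⟨ +-congˡ (zeroˡ w) ⟩
        z + 0#              ≈⟨ +-identityʳ z ⟩
        z                   ∎

  det≈sarrus : ∀ A → det A ≈ sarrus A
  det≈sarrus A = cancel-ε (prove (env A A)
    (Poly.det X :+ ε :* q)
    (PolySarrus.sarrus X :+ ε :* (var 0F :* q))
    refl)
    where
    q : Polynomial 19
    -- Write m for `var 0F`. Laplace expansion yields m² and m³ where Sarrus has 1 and m, so the
    -- difference is (m² - 1) `q` = (1 + m)(m - 1) `q`.
    q = X 0F 1F :* (X 1F 2F :* X 2F 0F) :+ (X 0F 2F :* (X 1F 0F :* X 2F 1F)
        :+ var 0F :* (X 0F 2F :* (X 1F 1F :* X 2F 0F)))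

  sarrus-* : ∀ A B → sarrus (A Matrix₃.* B) ≈ sarrus A * sarrus B
  sarrus-* A B = cancel-ε (prove (env A B)
    -- `even XY` is `even X :* even Y :+ odd X :* odd Y` plus terms using a row of `Y` twice.
    -- `odd XY` consists of the two mixed products plus those same terms, which therefore carry the
    -- factor `ε` in `sarrusₚ XY`.
    (sarrusₚ XY :+ ε :* (even X :* odd Y :+ odd X :* even Y :+ var 0F :* (odd X :* odd Y)))
    (sarrusₚ X :* sarrusₚ Y :+ ε :* (odd XY :+ odd X :* odd Y))
    refl)
    where open PolySarrus renaming (evenTerms to even; oddTerms to odd; sarrus to sarrusₚ)

  det-* : ∀ (A B : Matrix 3) → det (A Matrix₃.* B) ≈ det A * det B
  det-* A B = begin
    det (A Matrix₃.* B)      ≈⟨ det≈sarrus (A Matrix₃.* B) ⟩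
    sarrus (A Matrix₃.* B)   ≈⟨ sarrus-* A B ⟩
    sarrus A * sarrus B      ≈⟨ *-cong (det≈sarrus A) (det≈sarrus B) ⟨
    det A * det B            ∎

  det-scalar : ∀ x → det {3} (scalar x) ≈ x * (x * x)
  -- `env` serves here to give the variable `X 0F 0F` the value `x`.
  det-scalar x = prove (env (scalar x) (scalar x))
    (Poly.det (Poly.scalar {3} (X 0F 0F))) (X 0F 0F :* (X 0F 0F :* X 0F 0F)) refl

  det-scalar-1 : det {3} (scalar 1#) ≈ 1#
  det-scalar-1 = trans (det-scalar 1#) (trans (*-identityˡ _) (*-identityˡ 1#))

  -- The sign survives because the size of the matrix is odd.
  det-scalar--1 : det {3} (scalar (- 1#)) ≈ - 1#
  det-scalar--1 = begin
    det {3} (scalar (- 1#))   ≈⟨ det-scalar (- 1#) ⟩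
    - 1# * (- 1# * - 1#)      ≈⟨ *-congˡ (-1*x≈-x (- 1#)) ⟩
    - 1# * - - 1#             ≈⟨ *-congˡ (-‿involutive 1#) ⟩
    - 1# * 1#                 ≈⟨ *-identityʳ (- 1#) ⟩
    - 1#                      ∎

-- Powers of an element of reduced norm one.

module _ {e ℓe d ℓd} {E : CommutativeRing e ℓe} {D : Ring d ℓd}
         {κ : CommutativeRing.Carrier E → Ring.Carrier D}
         (E-isNumberField : IsNumberField E)
         (D-isCentral : IsCentralDivisionAlgebra E D κ 3)
         {Nrd : Ring.Carrier D → CommutativeRing.Carrier E}
         (Nrd-isReducedNorm : IsReducedNorm E D κ 3 Nrd) where

  private
    module E = CommutativeRing E
    module D = Ring D
    module κ = IsRingHomomorphism (IsCentralDivisionAlgebra.isHomo D-isCentral)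

  open IsReducedNorm Nrd-isReducedNorm
  open Splitting splitting
  open Determinant L
  open SemiringExp D.semiring using (_^_; ^-assocʳ)
  private
    module φ = IsRingHomomorphism φ-isHomo
    module ⌊⌋ = IsRingHomomorphism ⌊⌋-isHomo
  open SetoidReasoning L.setoid

  -- The rationals map to `L` through `E`, so -1 = 1 would collapse the field `L`.
  L-1≉1 : ¬ (L.- L.1# L.≈ L.1#)
  L-1≉1 -1≈1 = IsDivisionRing.1≉0 isField
    (ℚ-algebra∧-1≈1⇒1≈0 L.ring
      (isRingHomomorphism L.trans (IsNumberField.fromℚ-isHomo E-isNumberField) ⌊⌋-isHomo)
      -1≈1)

  -- Multiplicativity comes from determinants over `L`, where `Nrd g` becomes `det (φ g)`.
  det-φ-^ : ∀ g → Nrd g E.≈ E.1# → ∀ n → det (φ (g ^ n)) L.≈ L.1#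
  det-φ-^ g Nrd≈1 zero = L.trans (det-cong φ.1#-homo) det-scalar-1
  det-φ-^ g Nrd≈1 (suc n) = begin
    det (φ (g D.* g ^ n))               ≈⟨ det-cong (φ.*-homo g (g ^ n)) ⟩
    det (RawRing._*_ (matrixRing 3) (φ g) (φ (g ^ n)))  ≈⟨ det-* (φ g) (φ (g ^ n)) ⟩
    det (φ g) L.* det (φ (g ^ n))       ≈⟨ L.*-cong (L.sym (Nrd-det g)) (det-φ-^ g Nrd≈1 n) ⟩
    ⌊ Nrd g ⌋ L.* L.1#                  ≈⟨ L.*-identityʳ _ ⟩
    ⌊ Nrd g ⌋                           ≈⟨ ⌊⌋.⟦⟧-cong Nrd≈1 ⟩
    ⌊ E.1# ⌋                            ≈⟨ ⌊⌋.1#-homo ⟩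
    L.1#                                ∎

  κ-1≈-1 : κ (E.- E.1#) D.≈ D.- D.1#
  κ-1≈-1 = D.trans (κ.-‿homo E.1#) (D.-‿cong κ.1#-homo)

  -- As -1 comes from the centre through `κ`, `φ-linear` makes its image a scalar matrix.
  det-φ--1 : det (φ (D.- D.1#)) L.≈ L.- L.1#
  det-φ--1 = begin
    det (φ (D.- D.1#))              ≈⟨ det-cong (φ.⟦⟧-cong κ-1≈-1) ⟨
    det (φ (κ (E.- E.1#)))          ≈⟨ det-cong (φ-linear (E.- E.1#)) ⟩
    det {3} (scalar ⌊ E.- E.1# ⌋)   ≈⟨ det-scalar _ ⟩
    cube ⌊ E.- E.1# ⌋               ≈⟨ L.*-cong ⌊-1⌋≈-1 (L.*-cong ⌊-1⌋≈-1 ⌊-1⌋≈-1) ⟩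
    cube (L.- L.1#)                 ≈⟨ det-scalar (L.- L.1#) ⟨
    det {3} (scalar (L.- L.1#))     ≈⟨ det-scalar--1 ⟩
    L.- L.1#                        ∎
    where
    cube : L.Carrier → L.Carrier
    cube x = x L.* (x L.* x)

    ⌊-1⌋≈-1 : ⌊ E.- E.1# ⌋ L.≈ L.- L.1#
    ⌊-1⌋≈-1 = L.trans (⌊⌋.-‿homo E.1#) (L.-‿cong ⌊⌋.1#-homo)

  Nrd≈1⇒power≉-1 : ∀ g → Nrd g E.≈ E.1# → ∀ n → ¬ (g ^ n D.≈ D.- D.1#)
  Nrd≈1⇒power≉-1 g Nrd≈1 n gⁿ≈-1 = L-1≉1 (begin
    L.- L.1#             ≈⟨ det-φ--1 ⟨
    det (φ (D.- D.1#))   ≈⟨ det-cong (φ.⟦⟧-cong gⁿ≈-1) ⟨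
    det (φ (g ^ n))      ≈⟨ det-φ-^ g Nrd≈1 n ⟩
    L.1#                 ∎)

  Nrd≈1⇒power-not-reflection : ∀ g → Nrd g E.≈ E.1# → ∀ n → ¬ IsReflection D (g ^ n)
  Nrd≈1⇒power-not-reflection g Nrd≈1 n (gⁿ≉1 , g²ⁿ≈1) =
    Nrd≈1⇒power≉-1 g Nrd≈1 n
      (x²≈1∧x≉1⇒x≈-1 D (IsCentralDivisionAlgebra.isDivisionRing D-isCentral) g²ⁿ≈1 gⁿ≉1)

  Nrd≈1⇒order-not-even : ∀ g → Nrd g E.≈ E.1# → ∀ q → ¬ HasOrder D g (q ℕ.* 2)
  Nrd≈1⇒order-not-even g Nrd≈1 zero ord with () ← HasOrder.positive ord
  Nrd≈1⇒order-not-even g Nrd≈1 q@(suc _) ord = Nrd≈1⇒power-not-reflection g Nrd≈1 q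
    -- `q` is a positive exponent below the order `q ℕ.* 2`, so `g ^ q` is not one.
    ( HasOrder.minimal ord q z<s (m<m*n q 2 (s<s z<s))
    -- `(g ^ q) ^ 2` unfolds with a trailing factor `1#`, which is inserted first.
    , D.trans (D.*-congˡ (D.sym (D.*-identityʳ (g ^ q))))
        (D.trans (^-assocʳ g q 2) (HasOrder.power ord)))

theorem1p1 : ∀ {f ℓf e ℓe d ℓd}
    (F : CommutativeRing f ℓf) (E : CommutativeRing e ℓe) (D : Ring d ℓd) →
    IsNumberField F → IsNumberField E →
    (ι : CommutativeRing.Carrier F → CommutativeRing.Carrier E) →
    IsQuadraticExtension F E ι →
    (τ : CommutativeRing.Carrier E → CommutativeRing.Carrier E) →
    IsNontrivialGaloisElement F E ι τ →
    (κ : CommutativeRing.Carrier E → Ring.Carrier D) →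
    IsCentralDivisionAlgebra E D κ 3 →
    (α : Ring.Carrier D → Ring.Carrier D) →
    IsInvolutionOfSecondKind E D κ τ α →
    (Nrd : Ring.Carrier D → CommutativeRing.Carrier E) →
    IsReducedNorm E D κ 3 Nrd →
    (¬ (∃[ g ] (SU E D α Nrd g × ¬ (Ring._≈_ D g (Ring.1# D)) × (∃[ n ] (HasOrder D g n × 2 ∣ n)))))
    × (¬ (∃[ R ] (SU E D α Nrd R × IsReflection D R)))
theorem1p1 F E D _ E-isNumberField _ _ _ _ κ D-isCentral _ _ Nrd Nrd-isReducedNorm =
    (λ { (g , g∈SU , _ , _ , ord , divides q ≡.refl) →
         Nrd≈1⇒order-not-even E-isNumberField D-isCentral Nrd-isReducedNorm
           g (SU.special g∈SU) q ord })
  , (λ { (R , R∈SU , R≉1 , R²≈1) →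
         let open Ring D
             -- The power `R ^ 1` unfolds to `R * 1#`.
             R¹≈R = *-identityʳ R
         in Nrd≈1⇒power-not-reflection E-isNumberField D-isCentral Nrd-isReducedNorm
              R (SU.special R∈SU) 1
              ( (λ R¹≈1 → R≉1 (trans (sym R¹≈R) R¹≈1))
              , trans (*-cong R¹≈R R¹≈R) R²≈1 ) })
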